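{- Let $A=(a_1,\dots,a_n)$ be a finite sequence and $k$ a positive integer. Let $s$ be a non-negative real-valued function on the blocks of $A$ such that (i) $s(\emptyset)=0$ and $s(B)\ge 0$ for every block $B$, and (iii) $|s(B_1)-s(B_2)|\le 1$ whenever the blocks $B_1$ and $B_2$ differ by one element (their symmetric difference consists of exactly one term). Then there is a partition of $A$ into $k$ blocks $B_1,\dots,B_k$ such that $|s(B_i)-s(B_j)|\le 2$ for all $i,j\in[k]$.
   Context: A block of $A$ is either the empty set or a set of consecutive terms $\{a_i,a_{i+1},\dots,a_j\}$ with $i\le j$ (regarded as the set of positions $\{i,\dots,j\}$). A partition of $A$ into $k$ blocks is an ordered tuple $(B_1,\dots,B_k)$ given by integers $0=x_0\le x_1\le\dots\le x_k=n$ with $B_i=\{a_j:x_{i-1}<j\le x_i\}$; empty blocks are allowed. -}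

module Defs where

open import Level using (Level; suc; _⊔_)
open import Data.Nat as ℕ using (ℕ; zero; _<?_) renaming (suc to 1+)
open import Data.Nat.Properties using (≤-pred)
open import Data.Fin using (Fin; toℕ; fromℕ; inject₁) renaming (zero to fzero; suc to fsuc)
open import Data.Fin.Properties using (toℕ<n)
open import Data.Product using (Σ; _×_; _,_)
open import Data.Sum using (_⊎_)
open import Relation.Nullary using (¬_; yes; no)
open import Relation.Binary.PropositionalEquality using (_≡_)

record Reals (ℓ : Level) : Set (Level.suc ℓ) where
  infixl 6 _+_ _-_
  infixl 7 _*_
  infix  4 _≤_
  field
    ℝ    : Set ℓ
    0ℝ 1ℝ : ℝ
    _+_ _*_ : ℝ → ℝ → ℝ
    -_   : ℝ → ℝ
    _≤_  : ℝ → ℝ → Set ℓ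
    +-assoc  : ∀ x y z → (x + y) + z ≡ x + (y + z)
    +-comm   : ∀ x y → x + y ≡ y + x
    +-identityˡ : ∀ x → 0ℝ + x ≡ x
    -‿inverseˡ  : ∀ x → (- x) + x ≡ 0ℝ
    *-assoc  : ∀ x y z → (x * y) * z ≡ x * (y * z)
    *-comm   : ∀ x y → x * y ≡ y * x
    *-identityˡ : ∀ x → 1ℝ * x ≡ x
    distribˡ : ∀ x y z → x * (y + z) ≡ x * y + x * z
    0≢1      : ¬ (0ℝ ≡ 1ℝ)
    *-inverse : ∀ x → ¬ (x ≡ 0ℝ) → Σ ℝ (λ y → y * x ≡ 1ℝ)
    ≤-refl   : ∀ x → x ≤ x
    ≤-trans  : ∀ {x y z} → x ≤ y → y ≤ z → x ≤ z
    ≤-antisym : ∀ {x y} → x ≤ y → y ≤ x → x ≡ y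
    ≤-total  : ∀ x y → (x ≤ y) ⊎ (y ≤ x)
    +-mono-≤ : ∀ {x y} z → x ≤ y → x + z ≤ y + z
    *-nonneg : ∀ {x y} → 0ℝ ≤ x → 0ℝ ≤ y → 0ℝ ≤ x * y
    complete : (P : ℝ → Set ℓ) → Σ ℝ P → Σ ℝ (λ b → ∀ x → P x → x ≤ b) →
               Σ ℝ (λ u → (∀ x → P x → x ≤ u) ×
                          (∀ b → (∀ x → P x → x ≤ b) → u ≤ b))

  _-_ : ℝ → ℝ → ℝ
  x - y = x + (- y)

  2ℝ : ℝ
  2ℝ = 1ℝ + 1ℝ

  ∣_-_∣≤_ : ℝ → ℝ → ℝ → Set ℓ
  ∣ x - y ∣≤ c = (x - y ≤ c) × (y - x ≤ c)

-- Blocks of a sequence of length n, as sets of positions in {1,…,n}: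
-- the empty block, or {i,…,j} with 1 ≤ i ≤ j ≤ n.

data Block (n : ℕ) : Set where
  empty    : Block n
  interval : (i j : ℕ) → 1 ℕ.≤ i → i ℕ.≤ j → j ℕ.≤ n → Block n

_∈B_ : {n : ℕ} → ℕ → Block n → Set
p ∈B empty = Data.Empty.⊥ where import Data.Empty
p ∈B interval i j _ _ _ = (i ℕ.≤ p) × (p ℕ.≤ j)

InSymDiff : {n : ℕ} → Block n → Block n → ℕ → Set
InSymDiff B₁ B₂ p = ((p ∈B B₁) × ¬ (p ∈B B₂)) ⊎ ((p ∈B B₂) × ¬ (p ∈B B₁))

DifferByOne : {n : ℕ} → Block n → Block n → Set
DifferByOne B₁ B₂ = Σ ℕ (λ p → InSymDiff B₁ B₂ p × (∀ q → InSymDiff B₁ B₂ q → q ≡ p))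

segment : {n : ℕ} → Fin (1+ n) → Fin (1+ n) → Block n
segment {n} a b with toℕ a <? toℕ b
... | yes a<b = interval (1+ (toℕ a)) (toℕ b) (ℕ.s≤s ℕ.z≤n) a<b (≤-pred (toℕ<n b))
... | no  _   = empty

record Partition (n k : ℕ) : Set where
  field
    x      : Fin (1+ k) → Fin (1+ n)
    x-zero : toℕ (x fzero) ≡ 0
    x-last : toℕ (x (fromℕ k)) ≡ n
    x-mono : ∀ (i : Fin k) → toℕ (x (inject₁ i)) ℕ.≤ toℕ (x (fsuc i))

  -- B_i = {a_j : x_{i-1} < j ≤ x_i}, indexed by i ∈ Fin k (i.e. i-1)
  block : Fin k → Block n
  block i = segment (x (inject₁ i)) (x (fsuc i))

{-# OPTIONS --safe #-}
module Submission where

-- Some v has a partition all of whose blocks have value within 1 of v. Call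
-- (y , v) k-good if the first y terms split into k blocks with values within 1
-- of v. By induction on k there is a path of k-good points from (0 , 0) to y = n,
-- along which y changes by one or v by at most one at each step. Given such a
-- path (X t , val t), sign the grid point (t , y) according to whether the value
-- of (X t , y] is above or below val t. Both ends of a sign change are within 1
-- of val t, hence give (k+1)-good points (y , val t). The left column is positive
-- and the bottom row and the right column are negative, so a Hex-type parity
-- argument connects the sign change at the corner to one on the top row, and this
-- is the path for k + 1.

open import Defs
open import Level using (Level)
open import Algebra using (CommutativeRing; Ring)
open import Data.Bool using (Bool; true; false; _∧_; _∨_; _xor_)
open import Data.Bool.Properties
  using (xor-same; xor-identityʳ; xor-assoc; xor-∧-commutativeRing)
open import Algebra.Properties.CommutativeSemigroup
  (CommutativeRing.+-commutativeSemigroup xor-∧-commutativeRing) using (interchange)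
open import Data.Empty using (⊥-elim)
open import Data.Fin using (Fin; toℕ; fromℕ<)
import Data.Fin.Properties as Fin
open import Data.List using (List; []; _∷_; upTo; cartesianProduct)
open import Data.List.Membership.Propositional using (_∈_)
open import Data.List.Membership.Propositional.Properties using (∈-cartesianProduct⁺; ∈-upTo⁺)
open import Data.List.Relation.Unary.Any using (here; there)
open import Data.Nat as ℕ using (ℕ; zero; suc; z≤n; s≤s)
import Data.Nat.Properties as ℕ
open import Data.Product using (Σ; ∃; _×_; _,_; proj₁; proj₂; swap)
open import Data.Product.Properties using (≡-dec)
open import Data.Sum using (_⊎_; inj₁; inj₂)
open import Data.Vec using (Vec)
open import Function using (id; _∘_)
open import Relation.Binary using (Rel; DecidableEquality; IsEquivalence)
open import Relation.Binary.Construct.Closure.ReflexiveTransitive as Star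
  using (Star; ε; _◅_; _◅◅_)
open import Relation.Binary.PropositionalEquality
  using (_≡_; refl; sym; trans; cong; cong₂; subst; subst₂; isEquivalence; module ≡-Reasoning)
open import Relation.Nullary using (Dec; does; yes; no; contradiction)
open import Relation.Nullary.Decidable using (dec-true)

module _ {a ℓ} {V : Set a} (_≟_ : DecidableEquality V)
         {_∼_ : Rel V ℓ} (∼-equiv : IsEquivalence _∼_) where

  open IsEquivalence ∼-equiv renaming (refl to ∼-refl; sym to ∼-sym; trans to ∼-trans)

  merge : V → V → V → V
  merge u v w with w ≟ v
  ... | yes _ = u
  ... | no  _ = w

  merge-left : ∀ u v → merge u v u ≡ u
  merge-left u v with u ≟ v
  ... | yes _ = refl
  ... | no  _ = refl

  merge-right : ∀ u v → merge u v v ≡ u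
  merge-right u v with v ≟ v
  ... | yes _  = refl
  ... | no v≢v = contradiction refl v≢v

  merge-sound : (c : V → V) → (∀ {p q} → c p ≡ c q → p ∼ q) →
                ∀ {u v} → u ∼ v →
                ∀ {p q} → merge (c u) (c v) (c p) ≡ merge (c u) (c v) (c q) → p ∼ q
  merge-sound c sound {u} {v} u∼v {p} {q} eq with c p ≟ c v | c q ≟ c v
  ... | yes cp≡cv | yes cq≡cv = sound (trans cp≡cv (sym cq≡cv))
  ... | yes cp≡cv | no _      = ∼-trans (sound cp≡cv) (∼-trans (∼-sym u∼v) (sound eq))
  ... | no _      | yes cq≡cv = ∼-trans (sound eq) (∼-trans u∼v (∼-sym (sound cq≡cv)))
  ... | no _      | no _      = sound eq

  -- Union-find over the listed links. Since `∼` need not be decidable, the decidable relation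
  -- `c p ≡ c q` replaces it: it contains every active listed link and is contained in `∼`.
  label-components :
    ∀ {i} {I : Set i} (active : I → Bool) (l r : I → V) →
    (∀ e → active e ≡ true → l e ∼ r e) → (es : List I) →
    ∃ λ (c : V → V) →
      (∀ {e} → e ∈ es → active e ≡ true → c (l e) ≡ c (r e)) ×
      (∀ {p q} → c p ≡ c q → p ∼ q)
  label-components active l r link [] = id , (λ ()) , λ { refl → ∼-refl }
  label-components active l r link (e ∷ es)
    with label-components active l r link es | active e in e-active
  ... | c , joined , sound | false = c , joined′ , sound
    where
    joined′ : ∀ {e′} → e′ ∈ e ∷ es → active e′ ≡ true → c (l e′) ≡ c (r e′)
    joined′ (here refl) act with () ← trans (sym e-active) act
    joined′ (there e∈)  act = joined e∈ act
  ... | c , joined , sound | true =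
    merge (c (l e)) (c (r e)) ∘ c , joined′ , merge-sound c sound (link e e-active)
    where
    joined′ : ∀ {e′} → e′ ∈ e ∷ es → active e′ ≡ true →
              merge (c (l e)) (c (r e)) (c (l e′)) ≡ merge (c (l e)) (c (r e)) (c (r e′))
    joined′ (here refl) _   =
      trans (merge-left (c (l e)) (c (r e))) (sym (merge-right (c (l e)) (c (r e))))
    joined′ (there e∈)  act = cong (merge (c (l e)) (c (r e))) (joined e∈ act)

-- Parity of sign changes on a grid.

xor-telescope : ∀ a b c → (a xor b) xor (b xor c) ≡ a xor c
xor-telescope false b     c     = trans (sym (xor-assoc b b c)) (cong (_xor c) (xor-same b))
xor-telescope true  false c     = refl
xor-telescope true  true  c     = refl

-- h, h′ are the horizontal and v, v′ the vertical sides of a square, true when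
-- their ends differ in sign; A, B, D say whether the lower left, lower right and
-- upper left corners are marked.
square-parity :
  (h v h′ v′ : Bool) {A B D E : Bool} → h xor v′ ≡ v xor h′ →
  (h ∨ (v ∧ v′) ≡ true → A ≡ B) →
  (v ∨ (h ∧ h′) ≡ true → A ≡ D) →
  (h′ ≡ true → D ≡ E) →
  (v′ ≡ true → B ≡ E) →
  (h ∧ A) xor (h′ ∧ D) ≡ (v ∧ A) xor (v′ ∧ B)
square-parity false false false false _ AB AD DE BE = refl
square-parity false false true  true  _ AB AD DE BE = trans (DE refl) (sym (BE refl))
square-parity false true  false true  {A} _ AB AD DE BE
  rewrite sym (AB refl) = sym (xor-same A)
square-parity false true  true  false {A} _ AB AD DE BE =
  trans (sym (AD refl)) (sym (xor-identityʳ A))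
square-parity true  false false true  {A} _ AB AD DE BE = trans (xor-identityʳ A) (AB refl)
square-parity true  false true  false {A} _ AB AD DE BE
  rewrite sym (AD refl) = xor-same A
square-parity true  true  false false _ AB AD DE BE = refl
square-parity true  true  true  true  _ AB AD DE BE
  rewrite sym (AB refl) | sym (AD refl) = refl

true-∨ : ∀ {a b} → a ≡ true → a ∨ b ≡ true
true-∨ refl = refl

module _ (σ : ℕ → ℕ → Bool) where

  -- Besides the two ends of a sign change, a link joins parallel sign changes
  -- across a square; so all sign changes around a square lie in one component.
  changeʰ changeᵛ linkʰ linkᵛ : ℕ → ℕ → Bool
  changeʰ t y = σ t y xor σ (suc t) y
  changeᵛ t y = σ t y xor σ t (suc y)
  linkʰ t y = changeʰ t y ∨ (changeᵛ t y ∧ changeᵛ (suc t) y)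
  linkᵛ t y = changeᵛ t y ∨ (changeʰ t y ∧ changeʰ t (suc y))

  module _ (C : ℕ → ℕ → Bool) where

    row-parity : ℕ → ℕ → Bool
    row-parity y zero    = false
    row-parity y (suc t) = row-parity y t xor (changeʰ t y ∧ C t y)

    row-parity-witness : ∀ y t → row-parity y t ≡ true →
                         ∃ λ i → changeʰ i y ≡ true × C i y ≡ true
    row-parity-witness y (suc t) odd with changeʰ t y in change | C t y in marked
    ... | true  | true  = t , change , marked
    ... | true  | false = row-parity-witness y t (trans (sym (xor-identityʳ _)) odd)
    ... | false | _     = row-parity-witness y t (trans (sym (xor-identityʳ _)) odd)

    row-parity-zero : ∀ y t → (∀ i → σ i y ≡ false) → row-parity y t ≡ false
    row-parity-zero y zero    _   = refl
    row-parity-zero y (suc t) neg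
      rewrite neg t | neg (suc t) = trans (xor-identityʳ _) (row-parity-zero y t neg)

    module _ (T n : ℕ)
             (joinʰ : ∀ {t y} → t ℕ.≤ T → y ℕ.≤ n → linkʰ t y ≡ true → C t y ≡ C (suc t) y)
             (joinᵛ : ∀ {t y} → t ℕ.≤ T → y ℕ.≤ n → linkᵛ t y ≡ true → C t y ≡ C t (suc y)) where

      -- Sums `square-parity` over the squares of a horizontal strip. Each interior vertical side is
      -- counted twice and cancels, leaving the two ends.
      strip-parity : ∀ y t → y ℕ.< n → t ℕ.≤ T →
        row-parity y t xor row-parity (suc y) t ≡
        (changeᵛ 0 y ∧ C 0 y) xor (changeᵛ t y ∧ C t y)
      strip-parity y zero    y<n t≤T = sym (xor-same (changeᵛ 0 y ∧ C 0 y))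
      strip-parity y (suc t) y<n t<T = begin
        (r xor h) xor (r′ xor h′)  ≡⟨ interchange r h r′ h′ ⟩
        (r xor r′) xor (h xor h′)  ≡⟨ cong₂ _xor_ (strip-parity y t y<n (ℕ.<⇒≤ t<T)) square ⟩
        (v₀ xor v) xor (v xor v′)  ≡⟨ xor-telescope v₀ v v′ ⟩
        v₀ xor v′                  ∎
        where
        open ≡-Reasoning
        r  = row-parity y t
        r′ = row-parity (suc y) t
        h  = changeʰ t y ∧ C t y
        h′ = changeʰ t (suc y) ∧ C t (suc y)
        v₀ = changeᵛ 0 y ∧ C 0 y
        v  = changeᵛ t y ∧ C t y
        v′ = changeᵛ (suc t) y ∧ C (suc t) y
        y≤n = ℕ.<⇒≤ y<n
        t≤T = ℕ.<⇒≤ t<T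
        square : h xor h′ ≡ v xor v′
        square = square-parity (changeʰ t y) (changeᵛ t y) (changeʰ t (suc y)) (changeᵛ (suc t) y)
          -- Both routes around the square compare the same two opposite corners.
          (trans (xor-telescope (σ t y) (σ (suc t) y) (σ (suc t) (suc y)))
            (sym (xor-telescope (σ t y) (σ t (suc y)) (σ (suc t) (suc y)))))
          (joinʰ t≤T y≤n)
          (joinᵛ t≤T y≤n)
          (λ change → joinʰ t≤T y<n (true-∨ change))
          (λ change → joinᵛ t<T y≤n (true-∨ change))

      -- The only sign change on the left, bottom and right sides is at the corner.
      rows-odd :
        (∀ t → σ t 0 ≡ false) →
        (∀ y → σ 0 (suc y) ≡ true) →
        (∀ y → y ℕ.≤ n → σ T y ≡ false) →
        C 0 0 ≡ true →
        ∀ y → y ℕ.< n → row-parity (suc y) T ≡ true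
      rows-odd bottom left right C₀₀ y y<n =
        -- The strip gives the sum of its two row parities; adding the lower one isolates the upper.
        trans (sym (xor-involutive (row-parity y T) _))
          (trans (cong (row-parity y T xor_) (strip-parity y T y<n ℕ.≤-refl)) (go y y<n))
        where
        xor-involutive : ∀ a b → a xor (a xor b) ≡ b
        xor-involutive a b = trans (sym (xor-assoc a a b)) (cong (_xor b) (xor-same a))
        go : ∀ y → y ℕ.< n →
             row-parity y T xor ((changeᵛ 0 y ∧ C 0 y) xor (changeᵛ T y ∧ C T y)) ≡ true
        go zero    y<n
          rewrite row-parity-zero 0 T bottom | bottom 0 | left 0
                | C₀₀ | bottom T | right 1 y<n = refl
        go (suc y) y<n
          rewrite rows-odd bottom left right C₀₀ y (ℕ.<⇒≤ y<n)
                | left y | left (suc y)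
                | right (suc y) (ℕ.<⇒≤ y<n) | right (suc (suc y)) y<n = refl

  private
    _≟_ : DecidableEquality (ℕ × ℕ)
    _≟_ = ≡-dec ℕ._≟_ ℕ._≟_

  -- Mark the points in the component of (0 , 0).
  sign-change-crossing :
    ∀ {ℓ} {_∼_ : Rel (ℕ × ℕ) ℓ} → IsEquivalence _∼_ →
    (∀ t y → linkʰ t y ≡ true → (t , y) ∼ (suc t , y)) →
    (∀ t y → linkᵛ t y ≡ true → (t , y) ∼ (t , suc y)) →
    ∀ T n →
    (∀ t → σ t 0 ≡ false) →
    (∀ y → σ 0 (suc y) ≡ true) →
    (∀ y → y ℕ.≤ suc n → σ T y ≡ false) →
    ∃ λ t → changeʰ t (suc n) ≡ true × (0 , 0) ∼ (t , suc n)
  sign-change-crossing {_∼_ = _∼_} ∼-equiv ∼ʰ ∼ᵛ T n bottom left right =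
    let t , change , marked = row-parity-witness C (suc n) T
          (rows-odd C T (suc n) (joined true) (joined false) bottom left right
            (dec-true (c (0 , 0) ≟ c (0 , 0)) refl) n ℕ.≤-refl)
    in t , change , sound (sym (does-true⇒holds (c (t , suc n) ≟ c (0 , 0)) marked))
    where
    -- `true` stands for a horizontal link and `false` for a vertical one; `upTo` excludes its
    -- bound, so the starting points are those with `t ≤ T` and `y ≤ suc n`.
    sides : List (Bool × ℕ × ℕ)
    sides = cartesianProduct (true ∷ false ∷ [])
              (cartesianProduct (upTo (suc T)) (upTo (suc (suc n))))
    end : Bool → ℕ → ℕ → ℕ × ℕ
    end true  t y = suc t , y
    end false t y = t , suc y
    link : Bool → ℕ → ℕ → Bool
    link true  = linkʰ
    link false = linkᵛ
    ∼-link : ∀ d t y → link d t y ≡ true → (t , y) ∼ end d t y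
    ∼-link true  = ∼ʰ
    ∼-link false = ∼ᵛ
    components = label-components _≟_ ∼-equiv
      (λ (d , t , y) → link d t y) (λ (d , t , y) → t , y) (λ (d , t , y) → end d t y)
      (λ (d , t , y) → ∼-link d t y) sides
    c = proj₁ components
    sound = proj₂ (proj₂ components)
    C : ℕ → ℕ → Bool
    C t y = does (c (t , y) ≟ c (0 , 0))
    does-true⇒holds : ∀ {a} {P : Set a} (p? : Dec P) → does p? ≡ true → P
    does-true⇒holds (yes p) _ = p
    direction∈ : ∀ d → d ∈ true ∷ false ∷ []
    direction∈ true  = here refl
    direction∈ false = there (here refl)
    joined : ∀ d {t y} → t ℕ.≤ T → y ℕ.≤ suc n → link d t y ≡ true →
             C t y ≡ (λ (t , y) → C t y) (end d t y)
    joined d t≤T y≤n active = cong (λ p → does (p ≟ c (0 , 0)))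
      (proj₁ (proj₂ components)
        (∈-cartesianProduct⁺ (direction∈ d)
          (∈-cartesianProduct⁺ (∈-upTo⁺ (s≤s t≤T)) (∈-upTo⁺ (s≤s y≤n)))) active)

-- The loop at `q` pads the path to an infinite sequence, constant from `T` on, so that grid columns
-- can be indexed by all naturals.
Star-sequence : ∀ {a ℓ} {A : Set a} {L : Rel A ℓ} {p q} → Star L p q → L q q →
                ∃ λ (f : ℕ → A) → ∃ λ T →
                f 0 ≡ p × f T ≡ q × (∀ t → L (f t) (f (suc t)))
Star-sequence {p = p} ε loop = (λ _ → p) , 0 , refl , refl , λ _ → loop
Star-sequence {A = A} {L} {p} (l ◅ ls) loop with Star-sequence ls loop
... | f , T , refl , end , steps = f′ , suc T , refl , end , steps′
  where
  f′ : ℕ → A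
  f′ zero    = p
  f′ (suc t) = f t
  steps′ : ∀ t → L (f′ t) (f′ (suc t))
  steps′ zero    = l
  steps′ (suc t) = steps t

∨-∧-cases : ∀ {a b c} → a ∨ (b ∧ c) ≡ true → a ≡ true ⊎ (b ≡ true × c ≡ true)
∨-∧-cases {true}                _ = inj₁ refl
∨-∧-cases {false} {true} {true} _ = inj₂ (refl , refl)

-- Nearness of reals.

module Nearness {ℓ} (R : Reals ℓ) where
  open Reals R

  ring : Ring ℓ ℓ
  ring = record
    { Carrier = ℝ ; _≈_ = _≡_ ; _+_ = _+_ ; _*_ = _*_ ; -_ = λ x → - x ; 0# = 0ℝ ; 1# = 1ℝ
    ; isRing = record
      { +-isAbelianGroup = record
        { isGroup = record
          { isMonoid = record
            { isSemigroup = record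
              { isMagma = record { isEquivalence = isEquivalence ; ∙-cong = cong₂ _+_ }
              ; assoc = +-assoc }
            ; identity = +-identityˡ , λ x → trans (+-comm x 0ℝ) (+-identityˡ x) }
          ; inverse = -‿inverseˡ , λ x → trans (+-comm x (- x)) (-‿inverseˡ x)
          ; ⁻¹-cong = cong (λ x → - x) }
        ; comm = +-comm }
      ; *-cong = cong₂ _*_
      ; *-assoc = *-assoc
      ; *-identity = *-identityˡ , λ x → trans (*-comm x 1ℝ) (*-identityˡ x)
      ; distrib = distribˡ , λ x y z → trans (*-comm (y + z) x)
          (trans (distribˡ x y z) (cong₂ _+_ (*-comm x y) (*-comm x z))) } }

  open Ring ring using (-‿inverseʳ; +-identityʳ)
  open import Algebra.Properties.Ring ring using (-1*x≈-x)
  open import Algebra.Properties.Group (Ring.+-group ring) using (⁻¹-involutive)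

  ≤-reflexive : ∀ {x y} → x ≡ y → x ≤ y
  ≤-reflexive refl = ≤-refl _

  0≤1 : 0ℝ ≤ 1ℝ
  0≤1 with ≤-total 0ℝ 1ℝ
  ... | inj₁ 0≤1 = 0≤1
  ... | inj₂ 1≤0 = subst (0ℝ ≤_) (trans (-1*x≈-x (- 1ℝ)) (⁻¹-involutive 1ℝ)) (*-nonneg 0≤-1 0≤-1)
    where
    0≤-1 : 0ℝ ≤ - 1ℝ
    0≤-1 = subst₂ _≤_ (-‿inverseʳ 1ℝ) (+-identityˡ (- 1ℝ)) (+-mono-≤ (- 1ℝ) 1≤0)

  x≤x+1 : ∀ x → x ≤ x + 1ℝ
  x≤x+1 x = subst₂ _≤_ (+-identityˡ x) (+-comm 1ℝ x) (+-mono-≤ x 0≤1)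

  x-y≤c⇒x≤y+c : ∀ {x y c} → x - y ≤ c → x ≤ y + c
  x-y≤c⇒x≤y+c {x} {y} {c} h = subst₂ _≤_
    (trans (+-assoc x (- y) y) (trans (cong (x +_) (-‿inverseˡ y)) (+-identityʳ x)))
    (+-comm c y) (+-mono-≤ y h)

  x≤y+c⇒x-y≤c : ∀ {x y c} → x ≤ y + c → x - y ≤ c
  x≤y+c⇒x-y≤c {x} {y} {c} h = subst (x - y ≤_)
    (trans (cong (λ z → z - y) (+-comm y c))
      (trans (+-assoc c y (- y)) (trans (cong (c +_) (-‿inverseʳ y)) (+-identityʳ c))))
    (+-mono-≤ (- y) h)

  infix 4 _≈₁_
  _≈₁_ : ℝ → ℝ → Set ℓ
  x ≈₁ y = x ≤ y + 1ℝ × y ≤ x + 1ℝ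

  ≈₁-refl : ∀ {x} → x ≈₁ x
  ≈₁-refl = x≤x+1 _ , x≤x+1 _

  -- The discrete substitute for the intermediate value theorem: it turns each sign change into
  -- nearness.
  ≈₁-between : ∀ {p q r} → p ≤ q → q ≤ r → p ≈₁ r → q ≈₁ p × q ≈₁ r
  ≈₁-between p≤q q≤r (_ , r≤p+1) =
    (≤-trans q≤r r≤p+1 , ≤-trans p≤q (x≤x+1 _)) ,
    (≤-trans q≤r (x≤x+1 _) , ≤-trans r≤p+1 (+-mono-≤ 1ℝ p≤q))

  -- The bound 2 arises here, as two distances of at most 1 to a common `v`.
  ≈₁-via : ∀ {x v y} → x ≈₁ v → y ≈₁ v → x - y ≤ 2ℝ
  ≈₁-via {x} {v} {y} (x≤v+1 , _) (_ , v≤y+1) = x≤y+c⇒x-y≤c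
    (≤-trans x≤v+1 (subst (v + 1ℝ ≤_) (+-assoc y 1ℝ 1ℝ) (+-mono-≤ 1ℝ v≤y+1)))

  -- Splittings and paths of good points; `g x y` is the value of the block (x , y].

  module Splitting (g : ℕ → ℕ → ℝ)
                   (g-empty : ∀ {x y} → y ℕ.≤ x → g x y ≡ 0ℝ)
                   (g-nonneg : ∀ x y → 0ℝ ≤ g x y)
                   (g-left : ∀ x y → g x y ≈₁ g (suc x) y)
                   (g-right : ∀ x y → g x y ≈₁ g x (suc y)) where

    data Split (v : ℝ) : ℕ → ℕ → Set ℓ where
      nil  : Split v 0 0
      snoc : ∀ {k x y} → Split v k x → x ℕ.≤ y → g x y ≈₁ v → Split v (suc k) y

    State : Set ℓ
    State = ℕ × ℝ

    -- Only one coordinate moves at a time, so that in each step either the block value or the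
    -- target stays fixed.
    data Step : State → State → Set ℓ where
      shift : ∀ {y v v′} → v ≈₁ v′ → Step (y , v) (y , v′)
      right : ∀ {y v} → Step (y , v) (suc y , v)
      left  : ∀ {y v} → Step (suc y , v) (y , v)

    Step-sym : ∀ {S S′} → Step S S′ → Step S′ S
    Step-sym (shift v≈v′) = shift (swap v≈v′)
    Step-sym right        = left
    Step-sym left         = right

    Step-value : ∀ {y v y′ v′} → Step (y , v) (y′ , v′) → v ≈₁ v′
    Step-value (shift v≈v′) = v≈v′
    Step-value right        = ≈₁-refl
    Step-value left         = ≈₁-refl

    -- The bound `0ℝ ≤ v` is carried along so that empty blocks, of value 0, never exceed the
    -- target.
    Splittable : ℕ → State → Set ℓ
    Splittable k (y , v) = 0ℝ ≤ v × Split v k y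

    Link : ℕ → State → State → Set ℓ
    Link k S S′ = Splittable k S × Splittable k S′ × Step S S′

    Link-sym : ∀ {k S S′} → Link k S S′ → Link k S′ S
    Link-sym (ok , ok′ , step) = ok′ , ok , Step-sym step

    -- The discrete stand-in for a connected set of pairs (y , v) reaching from
    -- (0 , 0) to y = n such that [0 , y] splits into k blocks of value about v.
    Path : ℕ → ℕ → Set ℓ
    Path k n = ∃ λ v → Splittable k (n , v) × Star (Link k) (0 , 0ℝ) (n , v)

    path-one : ∀ n → Path 1 n
    path-one n = g 0 n , ok ≈₁-refl , go n
      where
      ok : ∀ {y y′} → g 0 y ≈₁ g 0 y′ → Splittable 1 (y , g 0 y′)
      ok near = g-nonneg _ _ , snoc nil z≤n near
      go : ∀ y → Star (Link 1) (0 , 0ℝ) (y , g 0 y)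
      go zero    = subst (λ v → Star (Link 1) (0 , 0ℝ) (0 , v)) (sym (g-empty z≤n)) ε
      -- The target moves before the position; the intermediate point is good because `g 0 y` is
      -- near `g 0 (suc y)`.
      go (suc y) = go y ◅◅ (ok ≈₁-refl , ok (g-right 0 y) , shift (g-right 0 y))
                        ◅ (ok (g-right 0 y) , ok ≈₁-refl , right) ◅ ε

    -- Extending a path from k to k + 1 blocks.

    module Extend (k : ℕ) (f : ℕ → State) (T n : ℕ)
                  (start : f 0 ≡ (0 , 0ℝ)) (end : proj₁ (f T) ≡ suc n)
                  (links : ∀ t → Link k (f t) (f (suc t))) where

      X : ℕ → ℕ
      X t = proj₁ (f t)

      val : ℕ → ℝ
      val t = proj₂ (f t)

      val-nonneg : ∀ t → 0ℝ ≤ val t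
      val-nonneg t = proj₁ (proj₁ (links t))

      -- Points with y ≤ X t are always below, so that every sign change happens
      -- where X t ≤ y, i.e. where (X t , y] is a genuine last block.
      data Sign (t y : ℕ) : Bool → Set ℓ where
        above : X t ℕ.< y → val t ≤ g (X t) y → Sign t y true
        below : g (X t) y ≤ val t → Sign t y false

      below-empty : ∀ {t y} → y ℕ.≤ X t → Sign t y false
      below-empty {t} y≤X = below (≤-trans (≤-reflexive (g-empty y≤X)) (val-nonneg t))

      -- In column 0 the value is 0 and both signs may be admissible for y > 0;
      -- above is forced there, so that the boundary has a sign change at (0 , 0).
      sign : ∀ t y → ∃ (Sign t y)
      sign zero    zero    = false , below-empty z≤n
      sign zero    (suc y) = true , above
        (subst (ℕ._< suc y) (sym (cong proj₁ start)) (s≤s z≤n))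
        (≤-trans (≤-reflexive (cong proj₂ start)) (g-nonneg _ _))
      sign (suc t) y with y ℕ.≤? X (suc t) | ≤-total (g (X (suc t)) y) (val (suc t))
      ... | yes y≤X | _        = false , below-empty y≤X
      ... | no _    | inj₁ g≤v = false , below g≤v
      ... | no y≰X  | inj₂ v≤g = true , above (ℕ.≰⇒> y≰X) v≤g

      σ : ℕ → ℕ → Bool
      σ t y = proj₁ (sign t y)

      σ-empty : ∀ t y → y ℕ.≤ X (suc t) → σ (suc t) y ≡ false
      σ-empty t y y≤X with y ℕ.≤? X (suc t) | ≤-total (g (X (suc t)) y) (val (suc t))
      ... | yes _  | _ = refl
      ... | no y≰X | _ = contradiction y≤X y≰X

      σ-bottom : ∀ t → σ t 0 ≡ false
      σ-bottom zero    = refl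
      σ-bottom (suc t) = σ-empty t 0 z≤n

      σ-end : ∀ y → y ℕ.≤ suc n → σ T y ≡ false
      σ-end = go T end
        where
        go : ∀ T → X T ≡ suc n → ∀ y → y ℕ.≤ suc n → σ T y ≡ false
        go zero    eq with () ← trans (sym eq) (cong proj₁ start)
        go (suc T) eq y y≤n = σ-empty T y (subst (y ℕ.≤_) (sym eq) y≤n)

      state : ℕ × ℕ → State
      state (t , y) = y , val t

      Good : ℕ → ℕ → Set ℓ
      Good t y = Splittable (suc k) (state (t , y))

      good : ∀ t {y} → X t ℕ.≤ y → g (X t) y ≈₁ val t → Good t y
      good t X≤y near = val-nonneg t , snoc (proj₂ (proj₁ (links t))) X≤y near

      -- In a `shift` the block value is fixed and trapped between the two targets; in the other
      -- steps the target is fixed and trapped between two block values. Strictness of `x < y`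
      -- leaves room for `x′ ≤ y`.
      step-good : ∀ {x v x′ v′ y} → Step (x , v) (x′ , v′) →
                  x ℕ.< y → v ≤ g x y → g x′ y ≤ v′ →
                  x′ ℕ.≤ y × g x y ≈₁ v × g x′ y ≈₁ v′
      step-good (shift v≈v′) x<y v≤g g≤v′ = ℕ.<⇒≤ x<y , ≈₁-between v≤g g≤v′ v≈v′
      step-good {x} {y = y} right x<y v≤g g≤v =
        let near′ , near = ≈₁-between g≤v v≤g (swap (g-left x y))
        in x<y , swap near , swap near′
      step-good {x′ = x′} {y = y} left x<y v≤g g≤v =
        let near′ , near = ≈₁-between g≤v v≤g (g-left x′ y)
        in ℕ.≤-trans (ℕ.n≤1+n _) (ℕ.<⇒≤ x<y) , swap near , swap near′

      good-horizontal : ∀ {t y b b′} → Sign t y b → Sign (suc t) y b′ → b xor b′ ≡ true →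
                        Good t y × Good (suc t) y
      good-horizontal {t} (above X<y v≤g) (below g≤v) _ =
        let X′≤y , near , near′ = step-good (proj₂ (proj₂ (links t))) X<y v≤g g≤v
        in good t (ℕ.<⇒≤ X<y) near , good (suc t) X′≤y near′
      good-horizontal {t} (below g≤v) (above X<y v≤g) _ =
        let X′≤y , near , near′ = step-good (Step-sym (proj₂ (proj₂ (links t)))) X<y v≤g g≤v
        in good t X′≤y near′ , good (suc t) (ℕ.<⇒≤ X<y) near

      good-vertical : ∀ {t y b b′} → Sign t y b → Sign t (suc y) b′ → b xor b′ ≡ true →
                      Good t y × Good t (suc y)
      good-vertical {t} {y} (above X<y v≤g) (below g≤v) _ =
        let near′ , near = ≈₁-between g≤v v≤g (swap (g-right (X t) y))
        in good t (ℕ.<⇒≤ X<y) (swap near) , good t (ℕ.m≤n⇒m≤1+n (ℕ.<⇒≤ X<y)) (swap near′)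
      good-vertical {t} {y} (below g≤v) (above X<y v≤g) _ =
        let near , near′ = ≈₁-between g≤v v≤g (g-right (X t) y)
        -- The lower point may have `y` equal to `X t`, with an empty last block.
        in good t (ℕ.≤-pred X<y) (swap near) , good t (ℕ.<⇒≤ X<y) (swap near′)

      goodʰ : ∀ t y → changeʰ σ t y ≡ true → Good t y × Good (suc t) y
      goodʰ t y = good-horizontal (proj₂ (sign t y)) (proj₂ (sign (suc t) y))

      goodᵛ : ∀ t y → changeᵛ σ t y ≡ true → Good t y × Good t (suc y)
      goodᵛ t y = good-vertical (proj₂ (sign t y)) (proj₂ (sign t (suc y)))

      -- Reflexivity holds at every grid point, good or not, so goodness of an endpoint has to be
      -- supplied separately.
      _∼_ : Rel (ℕ × ℕ) ℓ
      p ∼ q = Star (Link (suc k)) (state p) (state q)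

      ∼-isEquivalence : IsEquivalence _∼_
      ∼-isEquivalence = record
        { refl = ε ; sym = Star.reverse Link-sym ; trans = _◅◅_ }

      -- Both ends are good, either by the sign change between them or by vertical sign changes at
      -- each. As `state` forgets `X t`, passing to the next column only shifts the target.
      linkʰ-∼ : ∀ t y → linkʰ σ t y ≡ true → (t , y) ∼ (suc t , y)
      linkʰ-∼ t y link = (proj₁ goods , proj₂ goods , shift (Step-value (proj₂ (proj₂ (links t))))) ◅ ε
        where
        goods : Good t y × Good (suc t) y
        goods with ∨-∧-cases {changeʰ σ t y} link
        ... | inj₁ change             = goodʰ t y change
        ... | inj₂ (change , change′) = proj₁ (goodᵛ t y change) , proj₁ (goodᵛ (suc t) y change′)

      linkᵛ-∼ : ∀ t y → linkᵛ σ t y ≡ true → (t , y) ∼ (t , suc y)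
      linkᵛ-∼ t y link = (proj₁ goods , proj₂ goods , right) ◅ ε
        where
        goods : Good t y × Good t (suc y)
        goods with ∨-∧-cases {changeᵛ σ t y} link
        ... | inj₁ change             = goodᵛ t y change
        ... | inj₂ (change , change′) = proj₁ (goodʰ t y change) , proj₁ (goodʰ t (suc y) change′)

      extended : Path (suc k) (suc n)
      extended =
        let t , change , path = sign-change-crossing σ ∼-isEquivalence linkʰ-∼ linkᵛ-∼ T n
              σ-bottom (λ _ → refl) σ-end
        in val t , proj₁ (goodʰ t (suc n) change) ,
           subst (λ v → Star (Link (suc k)) (0 , v) (suc n , val t)) (cong proj₂ start) path

    -- Induction on the number of blocks.

    path-suc : ∀ {k} n → Path k n → Path (suc k) n
    -- For `n = 0` the left and right columns of the grid may coincide. The constant path at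
    -- `(0 , 0ℝ)` serves instead, and `start` reads off that its only point is k-good.
    path-suc {k} zero (v , (0≤v , split) , path) =
      0ℝ , (≤-refl 0ℝ , snoc (start path) z≤n (subst (_≈₁ 0ℝ) (sym (g-empty z≤n)) ≈₁-refl)) , ε
      where
      start : Star (Link k) (0 , 0ℝ) (0 , v) → Split 0ℝ k 0
      start ε             = split
      start ((ok , _) ◅ _) = proj₂ ok
    path-suc {k} (suc n) (v , ok , path)
      with Star-sequence path (ok , ok , shift ≈₁-refl)
    ... | f , T , start , end , links = Extend.extended k f T n start (cong proj₁ end) links

    near-equal-split : ∀ k n → ∃ λ v → Split v (suc k) n
    near-equal-split k n = let v , (_ , split) , _ = path k in v , split
      where
      path : ∀ k → Path (suc k) n
      path zero    = path-one n
      path (suc k) = path-suc n (path k)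

    -- Cut points of a splitting.

    module _ {v : ℝ} where

      -- Made total on the naturals: indices past the number of blocks return the final end `y`.
      cut : ∀ {k y} → Split v k y → ℕ → ℕ
      cut nil _ = 0
      cut (snoc {k} {y = y} split _ _) i with i ℕ.≤? k
      ... | yes _ = cut split i
      ... | no  _ = y

      cut-zero : ∀ {k y} (split : Split v k y) → cut split 0 ≡ 0
      cut-zero nil              = refl
      cut-zero (snoc split _ _) = cut-zero split

      cut-last : ∀ {k y} (split : Split v k y) → cut split k ≡ y
      cut-last nil = refl
      cut-last (snoc {k} _ _ _) with suc k ℕ.≤? k
      ... | yes 1+k≤k = contradiction 1+k≤k ℕ.1+n≰n
      ... | no  _     = refl

      cut-step : ∀ {k y} (split : Split v k y) {i} → i ℕ.< k →
                 cut split i ℕ.≤ cut split (suc i) × g (cut split i) (cut split (suc i)) ≈₁ v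
      cut-step (snoc {k} split x≤y near) {i} i<1+k with i ℕ.≤? k | suc i ℕ.≤? k
      ... | no i≰k | _       = contradiction (ℕ.≤-pred i<1+k) i≰k
      ... | yes _  | yes i<k = cut-step split i<k
      -- Here `i` equals `k`, so the two cuts bound the last block.
      ... | yes i≤k | no i≮k
        rewrite ℕ.≤-antisym i≤k (ℕ.≮⇒≥ i≮k) | cut-last split = x≤y , near

    near-equal-cuts : ∀ k n → ∃ λ v → ∃ λ (c : ℕ → ℕ) → c 0 ≡ 0 × c (suc k) ≡ n ×
      (∀ i → i ℕ.< suc k → c i ℕ.≤ c (suc i) × g (c i) (c (suc i)) ≈₁ v)
    near-equal-cuts k n =
      let v , split = near-equal-split k n
      in v , cut split , cut-zero split , cut-last split , λ _ → cut-step split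

-- Segments whose ends move by one.

∈-segment⁺ : ∀ {n p} (a b : Fin (suc n)) → toℕ a ℕ.< p → p ℕ.≤ toℕ b → p ∈B segment a b
∈-segment⁺ a b a<p p≤b with toℕ a ℕ.<? toℕ b
... | yes _  = a<p , p≤b
... | no a≮b = ⊥-elim (a≮b (ℕ.<-≤-trans a<p p≤b))

∈-segment⁻ : ∀ {n p} (a b : Fin (suc n)) → p ∈B segment a b → toℕ a ℕ.< p × p ℕ.≤ toℕ b
∈-segment⁻ a b p∈ with toℕ a ℕ.<? toℕ b
... | yes _ = p∈

segment-empty : ∀ {n} (a b : Fin (suc n)) → toℕ b ℕ.≤ toℕ a → segment a b ≡ empty
segment-empty a b b≤a with toℕ a ℕ.<? toℕ b
... | yes a<b = contradiction a<b (ℕ.≤⇒≯ b≤a)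
... | no _    = refl

-- Segments are open on the left, so the position lost is `a′` itself; `a < b` ensures that it was
-- present.
segment-left : ∀ {n} (a a′ b : Fin (suc n)) → toℕ a′ ≡ suc (toℕ a) → toℕ a ℕ.< toℕ b →
               DifferByOne (segment a b) (segment a′ b)
segment-left a a′ b a′≡1+a a<b = toℕ a′ ,
  inj₁ (∈-segment⁺ a b (ℕ.≤-reflexive (sym a′≡1+a)) (subst (ℕ._≤ toℕ b) (sym a′≡1+a) a<b) ,
        λ a′∈ → ℕ.<-irrefl refl (proj₁ (∈-segment⁻ a′ b a′∈))) ,
  unique
  where
  unique : ∀ q → InSymDiff (segment a b) (segment a′ b) q → q ≡ toℕ a′
  unique q (inj₁ (q∈ , q∉)) =
    let a<q , q≤b = ∈-segment⁻ a b q∈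
    in ℕ.≤-antisym (ℕ.≮⇒≥ λ a′<q → q∉ (∈-segment⁺ a′ b a′<q q≤b))
                   (subst (ℕ._≤ q) (sym a′≡1+a) a<q)
  unique q (inj₂ (q∈ , q∉)) =
    let a′<q , q≤b = ∈-segment⁻ a′ b q∈
    in contradiction (∈-segment⁺ a b (ℕ.<-trans (ℕ.≤-reflexive (sym a′≡1+a)) a′<q) q≤b) q∉

-- The position gained is `b′`. Equality of `a` and `b` is allowed: the empty block then grows to a
-- singleton.
segment-right : ∀ {n} (a b b′ : Fin (suc n)) → toℕ b′ ≡ suc (toℕ b) → toℕ a ℕ.≤ toℕ b →
                DifferByOne (segment a b) (segment a b′)
segment-right a b b′ b′≡1+b a≤b = toℕ b′ ,
  inj₂ (∈-segment⁺ a b′ (subst (toℕ a ℕ.<_) (sym b′≡1+b) (s≤s a≤b)) ℕ.≤-refl ,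
        λ b′∈ → ℕ.1+n≰n (subst (ℕ._≤ toℕ b) b′≡1+b (proj₂ (∈-segment⁻ a b b′∈)))) ,
  unique
  where
  unique : ∀ q → InSymDiff (segment a b) (segment a b′) q → q ≡ toℕ b′
  unique q (inj₁ (q∈ , q∉)) =
    let a<q , q≤b = ∈-segment⁻ a b q∈
    in contradiction (∈-segment⁺ a b′ a<q
         (ℕ.≤-trans q≤b (ℕ.≤-trans (ℕ.n≤1+n _) (ℕ.≤-reflexive (sym b′≡1+b))))) q∉
  unique q (inj₂ (q∈ , q∉)) =
    let a<q , q≤b′ = ∈-segment⁻ a b′ q∈
    in ℕ.≤-antisym q≤b′ (subst (ℕ._≤ q) (sym b′≡1+b)
         (ℕ.≰⇒> λ q≤b → q∉ (∈-segment⁺ a b a<q q≤b)))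

-- Positions beyond n are identified with n, which extends s ∘ segment to all
-- pairs of naturals without losing the Lipschitz property.
clip : ∀ n → ℕ → Fin (suc n)
clip n m = fromℕ< (s≤s (ℕ.m⊓n≤n m n))

toℕ-clip : ∀ n m → toℕ (clip n m) ≡ m ℕ.⊓ n
toℕ-clip n m = Fin.toℕ-fromℕ< _

clip-mono : ∀ n {m m′} → m ℕ.≤ m′ → toℕ (clip n m) ℕ.≤ toℕ (clip n m′)
clip-mono n {m} {m′} m≤m′ =
  subst₂ ℕ._≤_ (sym (toℕ-clip n m)) (sym (toℕ-clip n m′)) (ℕ.⊓-monoˡ-≤ n m≤m′)

clip-suc : ∀ n m → clip n (suc m) ≡ clip n m ⊎ toℕ (clip n (suc m)) ≡ suc (toℕ (clip n m))
clip-suc n m with suc m ℕ.≤? n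
... | yes m<n = inj₂ (trans (toℕ-clip n (suc m)) (trans (ℕ.m≤n⇒m⊓n≡m m<n)
                  (cong suc (sym (trans (toℕ-clip n m) (ℕ.m≤n⇒m⊓n≡m (ℕ.<⇒≤ m<n)))))))
... | no m≮n  = inj₁ (Fin.toℕ-injective (trans (toℕ-clip n (suc m))
                  (trans (ℕ.m≥n⇒m⊓n≡n (ℕ.m≤n⇒m≤1+n n≤m))
                    (sym (trans (toℕ-clip n m) (ℕ.m≥n⇒m⊓n≡n n≤m))))))
  where n≤m = ℕ.≮⇒≥ m≮n

-- Equality occurs when clipping absorbs the step or when both segments are empty.
segment-clip-left : ∀ n x y → let b = clip n y in
  segment (clip n x) b ≡ segment (clip n (suc x)) b ⊎
  DifferByOne (segment (clip n x) b) (segment (clip n (suc x)) b)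
segment-clip-left n x y with clip-suc n x | ℕ.≤-<-connex (toℕ (clip n y)) (toℕ (clip n x))
... | inj₁ same | _        = inj₁ (cong (λ a → segment a (clip n y)) (sym same))
... | inj₂ next | inj₂ a<b = inj₂ (segment-left _ _ _ next a<b)
... | inj₂ next | inj₁ b≤a = inj₁ (trans (segment-empty _ _ b≤a)
        (sym (segment-empty _ _ (ℕ.≤-trans b≤a (clip-mono n (ℕ.n≤1+n x))))))

segment-clip-right : ∀ n x y → let a = clip n x in
  segment a (clip n y) ≡ segment a (clip n (suc y)) ⊎
  DifferByOne (segment a (clip n y)) (segment a (clip n (suc y)))
segment-clip-right n x y with clip-suc n y | ℕ.≤-<-connex (toℕ (clip n x)) (toℕ (clip n y))
... | inj₁ same | _        = inj₁ (cong (segment (clip n x)) (sym same))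
... | inj₂ next | inj₁ a≤b = inj₂ (segment-right _ _ _ next a≤b)
... | inj₂ next | inj₂ b<a = inj₁ (trans (segment-empty _ _ (ℕ.<⇒≤ b<a))
        (sym (segment-empty _ _ (subst (ℕ._≤ toℕ (clip n x)) (sym next) b<a))))

-- From near-equal cuts to a partition.

theorem4p2 : {ℓ : Level} (R : Reals ℓ) → let open Reals R in
    {X : Set} (n : ℕ) (A : Vec X n) (k : ℕ) → 1 ℕ.≤ k →
    (s : Block n → ℝ) →
    s empty ≡ 0ℝ →
    (∀ B → 0ℝ ≤ s B) →
    (∀ B₁ B₂ → DifferByOne B₁ B₂ → ∣ s B₁ - s B₂ ∣≤ 1ℝ) →
    Σ (Partition n k) (λ P → ∀ (i j : Fin k) →
    ∣ s (Partition.block P i) - s (Partition.block P j) ∣≤ 2ℝ)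
theorem4p2 R n A (suc k) _ s s-empty s-nonneg s-lipschitz =
  from-cuts (near-equal-cuts k n)
  where
  open Reals R
  open Nearness R

  g : ℕ → ℕ → ℝ
  g x y = s (segment (clip n x) (clip n y))

  near : ∀ {B B′} → B ≡ B′ ⊎ DifferByOne B B′ → s B ≈₁ s B′
  near (inj₁ refl) = ≈₁-refl
  near (inj₂ diff) =
    let ≤₁ , ≥₁ = s-lipschitz _ _ diff in x-y≤c⇒x≤y+c ≤₁ , x-y≤c⇒x≤y+c ≥₁

  g-empty : ∀ {x y} → y ℕ.≤ x → g x y ≡ 0ℝ
  g-empty y≤x = trans (cong s (segment-empty _ _ (clip-mono n y≤x))) s-empty

  g-left : ∀ x y → g x y ≈₁ g (suc x) y
  g-left x y = near (segment-clip-left n x y)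

  g-right : ∀ x y → g x y ≈₁ g x (suc y)
  g-right x y = near (segment-clip-right n x y)

  open Splitting g g-empty (λ _ _ → s-nonneg _) g-left g-right

  from-cuts : (∃ λ v → ∃ λ (c : ℕ → ℕ) → c 0 ≡ 0 × c (suc k) ≡ n ×
                (∀ i → i ℕ.< suc k → c i ℕ.≤ c (suc i) × g (c i) (c (suc i)) ≈₁ v)) →
              Σ (Partition n (suc k)) (λ P → ∀ i j →
                ∣ s (Partition.block P i) - s (Partition.block P j) ∣≤ 2ℝ)
  from-cuts (v , c , c-zero , c-last , c-step) =
    partition , λ i j → ≈₁-via (block-near i) (block-near j) , ≈₁-via (block-near j) (block-near i)
    where
    partition : Partition n (suc k)
    partition = record
      -- `g` clips in the same way, so up to `toℕ (inject₁ i)` the value of a block is by definition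
      -- `g` of two consecutive cuts.
      { x = λ i → clip n (c (toℕ i))
      ; x-zero = trans (toℕ-clip n _) (cong (ℕ._⊓ n) c-zero)
      ; x-last = trans (toℕ-clip n _) (trans (cong (ℕ._⊓ n)
          (trans (cong c (Fin.toℕ-fromℕ (suc k))) c-last)) (ℕ.⊓-idem n))
      ; x-mono = λ i → clip-mono n (subst (λ m → c m ℕ.≤ c (suc (toℕ i)))
          (sym (Fin.toℕ-inject₁ i)) (proj₁ (c-step (toℕ i) (Fin.toℕ<n i))))
      }

    block-near : ∀ i → s (Partition.block partition i) ≈₁ v
    block-near i = subst (λ m → g (c m) (c (suc (toℕ i))) ≈₁ v)
      (sym (Fin.toℕ-inject₁ i)) (proj₂ (c-step (toℕ i) (Fin.toℕ<n i)))
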